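{- Let $\lambda=(\lambda_1,\lambda_2)$ be an integer partition with exactly $n=2$ (nonzero) parts, so $\lambda_1\ge\lambda_2>0$. Let $M=(m_{i,j})_{1\le i,j\le 2}$ be a minimal matrix of shape $\lambda$, i.e. a $2\times 2$ matrix with nonnegative integer entries whose RSK shape is $\lambda$ and whose number of inversions is the smallest among all $2\times 2$ nonnegative integer matrices of RSK shape $\lambda$. Then $M$ is symmetric and Hankel. Moreover, \[ M=\begin{bmatrix} s_2 & \lambda_2\\ \lambda_2 & s_4\end{bmatrix}, \] where $s_2=k$ and $s_4=\lambda_1-\lambda_2-k$ for some $k\in\{0,1,\ldots,\lambda_1-\lambda_2\}$.
   Context: Robinson–Schensted–Knuth (RSK) correspondence: an $n\times n$ matrix $M=(m_{i,j})$ with nonnegative integer entries is encoded as the two-line array (generalised permutation) obtained by listing each pair $(i,j)$ exactly $m_{i,j}$ times, sorted so that the top row is weakly increasing and, among equal top entries, bottom entries are weakly increasing. RSK row-inserts the bottom entries successively (an inserted entry $x$ is placed at the end of a row if it is $\ge$ all entries there, otherwise it bumps the leftmost entry strictly greater than $x$ into the next row) and records the top entries in a second tableau, producing a pair $(P,Q)$ of semistandard Young tableaux of the same shape; this common partition shape is called the (RSK) shape of $M$. For a partition $\lambda$ with $n$ parts, $\mathcal{M}_\lambda$ denotes the set of $n\times n$ nonnegative integer matrices of shape $\lambda$. An inversion of $M$ is a pair of positions $(i,j),(k,l)$ with $m_{i,j},m_{k,l}>0$, $i<k$ and $j>l$, counted with multiplicity, so the number of inversions of $M$ is $\sum_{i<k,\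 j>l} m_{i,j}m_{k,l}$. A matrix in $\mathcal{M}_\lambda$ attaining the minimum number of inversions over $\mathcal{M}_\lambda$ is called a minimal matrix of shape $\lambda$. A matrix $M=(m_{i,j})$ is Hankel if there is a sequence $s_2,\dots,s_{2n}$ with $m_{i,j}=s_{i+j}$ for all $i,j$. -}

module Defs where

open import Data.Nat using (ℕ; zero; suc; _+_; _*_; _<ᵇ_; _≤_)
open import Data.Fin using (Fin; toℕ)
open import Data.List using (List; []; _∷_; map; length; foldl; concatMap; replicate; allFin)
open import Data.Nat.ListAction using (sum)
open import Data.Maybe using (Maybe; just; nothing)
open import Data.Product using (_×_; _,_; Σ; ∃)
open import Data.Bool using (if_then_else_)
open import Relation.Binary.PropositionalEquality using (_≡_)

Matrix : ℕ → Set
Matrix n = Fin n → Fin n → ℕ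

twoLineArray : ∀ {n} → Matrix n → List (ℕ × ℕ)
twoLineArray {n} M =
  concatMap (λ i → concatMap (λ j → replicate (M i j) (toℕ i , toℕ j)) (allFin n)) (allFin n)

insertRow : ℕ → List ℕ → List ℕ × Maybe ℕ
insertRow x [] = (x ∷ [] , nothing)
insertRow x (y ∷ ys) with x <ᵇ y
... | Data.Bool.true  = (x ∷ ys , just y)
... | Data.Bool.false with insertRow x ys
...   | (r , b) = (y ∷ r , b)

insertP : ℕ → List (List ℕ) → List (List ℕ)
insertP x [] = (x ∷ []) ∷ []
insertP x (row ∷ rows) with insertRow x row
... | (r , nothing) = r ∷ rows
... | (r , just y)  = r ∷ insertP y rows

rskP : ∀ {n} → Matrix n → List (List ℕ)
rskP M = foldl (λ T p → insertP (Data.Product.proj₂ p) T) [] (twoLineArray M)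

-- RSK shape (common shape of P and Q): list of row lengths of P.
rskShape : ∀ {n} → Matrix n → List ℕ
rskShape M = map length (rskP M)

inversions : ∀ {n} → Matrix n → ℕ
inversions {n} M =
  sum (map (λ i → sum (map (λ j → sum (map (λ k → sum (map (λ l →
    if (toℕ i <ᵇ toℕ k) then (if (toℕ l <ᵇ toℕ j) then M i j * M k l else 0) else 0)
    (allFin n))) (allFin n))) (allFin n))) (allFin n))

IsMinimal : ∀ {n} → List ℕ → Matrix n → Set
IsMinimal {n} sh M =
  rskShape M ≡ sh × (∀ (M' : Matrix n) → rskShape M' ≡ sh → inversions M ≤ inversions M')

Symmetric : ∀ {n} → Matrix n → Set
Symmetric M = ∀ i j → M i j ≡ M j i

-- Hankel: m i j = s (i + j) for some sequence s (0-based indices).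
Hankel : ∀ {n} → Matrix n → Set
Hankel M = Σ (ℕ → ℕ) (λ s → ∀ i j → M i j ≡ s (toℕ i + toℕ j))

{-# OPTIONS --safe #-}
-- For M = [[a, b], [c, d]] the two-line array only involves the letters 0 and 1,
-- and each of the c zeros inserted after the b ones bumps one 1 into the second
-- row.  So P has first row 0^(a+c) 1^((b ∸ c) + d) and second row 1^(min b c),
-- while M has b c inversions.  A two-row shape λ thus forces min b c = λ₂; the
-- competitor [[0, λ₂], [λ₂, λ₁ - λ₂]] of shape λ has λ₂² inversions, so
-- minimality gives b c ≤ (min b c)², i.e. b = c = λ₂, and the length of the
-- first row then gives a + d = λ₁ - λ₂.
module Submission where

open import Defs
open import Data.Nat using (ℕ; zero; suc; _+_; _*_; _∸_; _⊓_; _≤_; _<_; NonZero; >-nonZero)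
open import Data.Nat.Properties
open import Data.Fin using (zero; suc; toℕ)
open import Data.Fin.Patterns using (0F; 1F)
open import Algebra.Properties.CommutativeSemigroup +-commutativeSemigroup using (xy∙z≈xz∙y)
open import Data.List using (List; []; _∷_; _++_; replicate; foldl; length; map)
open import Data.List.Properties using (length-++; length-replicate; ++-assoc; ++-identityʳ; ∷-injectiveˡ)
open import Data.Maybe using (just; nothing)
open import Data.Product using (_×_; _,_; ∃; proj₁; proj₂; swap)
open import Data.Sum using (inj₁; inj₂)
open import Relation.Binary.PropositionalEquality using (_≡_; refl; sym; trans; cong; cong₂; subst; subst₂; module ≡-Reasoning)

row : ℕ → ℕ → List ℕ
row p q = replicate p 0 ++ replicate q 1

length-row : ∀ p q → length (row p q) ≡ p + q
length-row p q = begin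
  length (row p q)                                ≡⟨ length-++ (replicate p 0) ⟩
  length (replicate p 0) + length (replicate q 1) ≡⟨ cong₂ _+_ (length-replicate p) (length-replicate q) ⟩
  p + q                                           ∎
  where open ≡-Reasoning

insertRow-1 : ∀ p q → insertRow 1 (row p q) ≡ (row p (suc q) , nothing)
insertRow-1 zero    zero    = refl
insertRow-1 zero    (suc q) rewrite insertRow-1 zero q = refl
insertRow-1 (suc p) q       rewrite insertRow-1 p q = refl

insertRow-0-bump : ∀ p q → insertRow 0 (row p (suc q)) ≡ (row (suc p) q , just 1)
insertRow-0-bump zero    q = refl
insertRow-0-bump (suc p) q rewrite insertRow-0-bump p q = refl

insertRow-0-append : ∀ p → insertRow 0 (row p 0) ≡ (row (suc p) 0 , nothing)
insertRow-0-append zero    = refl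
insertRow-0-append (suc p) rewrite insertRow-0-append p = refl

-- First row 0ᵖ1^q, second row 1ʳ, empty rows omitted as insertP does.  The clause
-- on r comes first so that tableau p q (suc r) computes for variable p and q.
tableau : ℕ → ℕ → ℕ → List (List ℕ)
tableau p    q    (suc r) = row p q ∷ replicate (suc r) 1 ∷ []
tableau zero zero zero    = []
tableau p    q    zero    = row p q ∷ []

insertP-1 : ∀ p q r → insertP 1 (tableau p q r) ≡ tableau p (suc q) r
insertP-1 p       q       (suc r) rewrite insertRow-1 p q = refl
insertP-1 zero    zero    zero    = refl
insertP-1 zero    (suc q) zero    rewrite insertRow-1 zero (suc q) = refl
insertP-1 (suc p) q       zero    rewrite insertRow-1 (suc p) q = refl

insertP-0-bump : ∀ p q r → insertP 0 (tableau p (suc q) r) ≡ tableau (suc p) q (suc r)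
insertP-0-bump p       q (suc r) rewrite insertRow-0-bump p q | insertRow-1 0 (suc r) = refl
insertP-0-bump zero    q zero    = refl
insertP-0-bump (suc p) q zero    rewrite insertRow-0-bump (suc p) q = refl

insertP-0-append : ∀ p r → insertP 0 (tableau p 0 r) ≡ tableau (suc p) 0 r
insertP-0-append p       (suc r) rewrite insertRow-0-append p = refl
insertP-0-append zero    zero    = refl
insertP-0-append (suc p) zero    rewrite insertRow-0-append (suc p) = refl

shape-tableau : ∀ p q r .{{_ : NonZero r}} → map length (tableau p q r) ≡ (p + q) ∷ r ∷ []
shape-tableau p q (suc r) = cong₂ (λ l₁ l₂ → l₁ ∷ l₂ ∷ []) (length-row p q) (length-replicate (suc r))

shape-tableau-two-rows : ∀ {p q r l₁ l₂} → map length (tableau p q r) ≡ l₁ ∷ l₂ ∷ [] → p + q ≡ l₁ × r ≡ l₂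
shape-tableau-two-rows {zero}  {zero}  {zero}  ()
shape-tableau-two-rows {zero}  {suc q} {zero}  ()
shape-tableau-two-rows {suc p} {q}     {zero}  ()
shape-tableau-two-rows {p}     {q}     {suc r} eq with trans (sym (shape-tableau p q (suc r))) eq
... | refl = refl , refl

insertBottom : List (List ℕ) → ℕ × ℕ → List (List ℕ)
insertBottom T ij = insertP (proj₂ ij) T

foldl-insert-1s : ∀ i n p q r xs →
  foldl insertBottom (tableau p q r) (replicate n (i , 1) ++ xs) ≡ foldl insertBottom (tableau p (q + n) r) xs
foldl-insert-1s i zero    p q r xs rewrite +-identityʳ q = refl
foldl-insert-1s i (suc n) p q r xs rewrite insertP-1 p q r =
  trans (foldl-insert-1s i n p (suc q) r xs) (cong (λ q′ → foldl insertBottom (tableau p q′ r) xs) (sym (+-suc q n)))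

foldl-insert-0s-append : ∀ i n p r xs →
  foldl insertBottom (tableau p 0 r) (replicate n (i , 0) ++ xs) ≡ foldl insertBottom (tableau (p + n) 0 r) xs
foldl-insert-0s-append i zero    p r xs rewrite +-identityʳ p = refl
foldl-insert-0s-append i (suc n) p r xs rewrite insertP-0-append p r =
  trans (foldl-insert-0s-append i n (suc p) r xs) (cong (λ p′ → foldl insertBottom (tableau p′ 0 r) xs) (sym (+-suc p n)))

foldl-insert-0s : ∀ i n p q r xs →
  foldl insertBottom (tableau p q r) (replicate n (i , 0) ++ xs) ≡
  foldl insertBottom (tableau (p + n) (q ∸ n) (r + n ⊓ q)) xs
foldl-insert-0s i zero    p q       r xs rewrite +-identityʳ p | +-identityʳ r = refl
foldl-insert-0s i (suc n) p zero    r xs =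
  trans (foldl-insert-0s-append i (suc n) p r xs)
        (cong (λ r′ → foldl insertBottom (tableau (p + suc n) 0 r′) xs) (sym (+-identityʳ r)))
foldl-insert-0s i (suc n) p (suc q) r xs rewrite insertP-0-bump p q r =
  trans (foldl-insert-0s i n (suc p) q (suc r) xs)
        (cong₂ (λ p′ r′ → foldl insertBottom (tableau p′ (q ∸ n) r′) xs) (sym (+-suc p n)) (sym (+-suc r (n ⊓ q))))

matrix2 : ℕ → ℕ → ℕ → ℕ → Matrix 2
matrix2 a b c d 0F 0F = a
matrix2 a b c d 0F 1F = b
matrix2 a b c d 1F 0F = c
matrix2 a b c d 1F 1F = d

module _ (M : Matrix 2) where
  private
    a b c d : ℕ
    a = M 0F 0F
    b = M 0F 1F
    c = M 1F 0F
    d = M 1F 1F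

  twoLineArray-matrix2 :
    twoLineArray M ≡ replicate a (0 , 0) ++ replicate b (0 , 1) ++ replicate c (1 , 0) ++ replicate d (1 , 1) ++ []
  twoLineArray-matrix2 = begin
    (A ++ B ++ []) ++ (C ++ D ++ []) ++ [] ≡⟨ cong ((A ++ B ++ []) ++_) (++-identityʳ (C ++ D ++ [])) ⟩
    (A ++ B ++ []) ++ C ++ D ++ []         ≡⟨ ++-assoc A (B ++ []) (C ++ D ++ []) ⟩
    A ++ (B ++ []) ++ C ++ D ++ []         ≡⟨ cong (A ++_) (++-assoc B [] (C ++ D ++ [])) ⟩
    A ++ B ++ C ++ D ++ []                 ∎
    where
    open ≡-Reasoning
    A B C D : List (ℕ × ℕ)
    A = replicate a (0 , 0)
    B = replicate b (0 , 1)
    C = replicate c (1 , 0)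
    D = replicate d (1 , 1)

  rskP-matrix2 : rskP M ≡ tableau (a + c) (b ∸ c + d) (b ⊓ c)
  rskP-matrix2 = begin
    rskP M
      ≡⟨ cong (foldl insertBottom []) twoLineArray-matrix2 ⟩
    foldl insertBottom (tableau 0 0 0) (replicate a (0 , 0) ++ replicate b (0 , 1) ++ replicate c (1 , 0) ++ replicate d (1 , 1) ++ [])
      ≡⟨ foldl-insert-0s-append 0 a 0 0 _ ⟩
    foldl insertBottom (tableau a 0 0) (replicate b (0 , 1) ++ replicate c (1 , 0) ++ replicate d (1 , 1) ++ [])
      ≡⟨ foldl-insert-1s 0 b a 0 0 _ ⟩
    foldl insertBottom (tableau a b 0) (replicate c (1 , 0) ++ replicate d (1 , 1) ++ [])
      ≡⟨ foldl-insert-0s 1 c a b 0 _ ⟩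
    foldl insertBottom (tableau (a + c) (b ∸ c) (c ⊓ b)) (replicate d (1 , 1) ++ [])
      ≡⟨ foldl-insert-1s 1 d (a + c) (b ∸ c) (c ⊓ b) [] ⟩
    tableau (a + c) (b ∸ c + d) (c ⊓ b)
      ≡⟨ cong (tableau (a + c) (b ∸ c + d)) (⊓-comm c b) ⟩
    tableau (a + c) (b ∸ c + d) (b ⊓ c)
      ∎
    where open ≡-Reasoning

  rskShape-two-rows : ∀ {l₁ l₂} → rskShape M ≡ l₁ ∷ l₂ ∷ [] → a + c + (b ∸ c + d) ≡ l₁ × b ⊓ c ≡ l₂
  rskShape-two-rows eq = shape-tableau-two-rows (trans (sym (cong (map length) rskP-matrix2)) eq)

  rskShape-antidiagonal : ∀ {t} .{{_ : NonZero t}} → b ≡ t → c ≡ t → rskShape M ≡ (a + t + d) ∷ t ∷ []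
  rskShape-antidiagonal {t} b≡t c≡t = begin
    map length (rskP M)                               ≡⟨ cong (map length) rskP-matrix2 ⟩
    map length (tableau (a + c) (b ∸ c + d) (b ⊓ c)) ≡⟨ cong₂ (λ x y → map length (tableau (a + x) (y ∸ x + d) (y ⊓ x))) c≡t b≡t ⟩
    map length (tableau (a + t) (t ∸ t + d) (t ⊓ t)) ≡⟨ cong₂ (λ x y → map length (tableau (a + t) (x + d) y)) (n∸n≡0 t) (⊓-idem t) ⟩
    map length (tableau (a + t) d t)                 ≡⟨ shape-tableau (a + t) d t ⟩
    (a + t + d) ∷ t ∷ []                              ∎
    where open ≡-Reasoning

  trace-antidiagonal : ∀ {t l₁} .{{_ : NonZero t}} → b ≡ t → c ≡ t → rskShape M ≡ l₁ ∷ t ∷ [] → a + d ≡ l₁ ∸ t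
  trace-antidiagonal {t} {l₁} b≡t c≡t shape = begin
    a + d          ≡⟨ sym (m+n∸n≡m (a + d) t) ⟩
    a + d + t ∸ t  ≡⟨ cong (_∸ t) (xy∙z≈xz∙y a d t) ⟩
    a + t + d ∸ t  ≡⟨ cong (_∸ t) (∷-injectiveˡ (trans (sym (rskShape-antidiagonal b≡t c≡t)) shape)) ⟩
    l₁ ∸ t         ∎
    where open ≡-Reasoning

  inversions-matrix2 : inversions M ≡ b * c
  inversions-matrix2 = trans (+-identityʳ _) (trans (+-identityʳ _) (trans (+-identityʳ _) (+-identityʳ _)))

  symmetric-matrix2 : b ≡ c → Symmetric M
  symmetric-matrix2 b≡c 0F 0F = refl
  symmetric-matrix2 b≡c 0F 1F = b≡c
  symmetric-matrix2 b≡c 1F 0F = sym b≡c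
  symmetric-matrix2 b≡c 1F 1F = refl

  hankel-matrix2 : b ≡ c → Hankel M
  hankel-matrix2 b≡c = s , M≡s
    where
    s : ℕ → ℕ
    s 0             = a
    s 1             = b
    s (suc (suc _)) = d
    M≡s : ∀ i j → M i j ≡ s (toℕ i + toℕ j)
    M≡s 0F 0F = refl
    M≡s 0F 1F = refl
    M≡s 1F 0F = sym b≡c
    M≡s 1F 1F = refl

m≤n⇒m⊓n≡o∧m*n≤o*o⇒m≡o×n≡o : ∀ {m n o} .{{_ : NonZero o}} → m ≤ n → m ⊓ n ≡ o → m * n ≤ o * o → m ≡ o × n ≡ o
m≤n⇒m⊓n≡o∧m*n≤o*o⇒m≡o×n≡o {m} {n} {o} m≤n m⊓n≡o m*n≤o*o = m≡o , ≤-antisym n≤o (subst (_≤ n) m≡o m≤n)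
  where
  m≡o : m ≡ o
  m≡o = trans (sym (m≤n⇒m⊓n≡m m≤n)) m⊓n≡o
  n≤o : n ≤ o
  n≤o = *-cancelˡ-≤ o (subst (λ x → x * n ≤ o * o) m≡o m*n≤o*o)

m⊓n≡o∧m*n≤o*o⇒m≡o×n≡o : ∀ {m n o} .{{_ : NonZero o}} → m ⊓ n ≡ o → m * n ≤ o * o → m ≡ o × n ≡ o
m⊓n≡o∧m*n≤o*o⇒m≡o×n≡o {m} {n} {o} m⊓n≡o m*n≤o*o with ≤-total m n
... | inj₁ m≤n = m≤n⇒m⊓n≡o∧m*n≤o*o⇒m≡o×n≡o m≤n m⊓n≡o m*n≤o*o
... | inj₂ n≤m = swap (m≤n⇒m⊓n≡o∧m*n≤o*o⇒m≡o×n≡o n≤m (trans (⊓-comm n m) m⊓n≡o) (subst (_≤ o * o) (*-comm m n) m*n≤o*o))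

mainTheorem1 : (λ₁ λ₂ : ℕ) → λ₂ ≤ λ₁ → 0 < λ₂ →
    (M : Matrix 2) → IsMinimal (λ₁ ∷ λ₂ ∷ []) M →
    Symmetric M × Hankel M ×
    ∃ (λ k → k ≤ λ₁ ∸ λ₂ ×
      M zero zero ≡ k × M zero (suc zero) ≡ λ₂ ×
      M (suc zero) zero ≡ λ₂ × M (suc zero) (suc zero) ≡ λ₁ ∸ λ₂ ∸ k)
mainTheorem1 λ₁ λ₂ λ₂≤λ₁ 0<λ₂ M (shape , minimal) =
  symmetric-matrix2 M b≡c , hankel-matrix2 M b≡c , a , a≤λ₁∸λ₂ , refl , b≡λ₂ , c≡λ₂ , d≡λ₁∸λ₂∸a
  where
  instance
    λ₂-nonZero : NonZero λ₂
    λ₂-nonZero = >-nonZero 0<λ₂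
  a b c d : ℕ
  a = M 0F 0F
  b = M 0F 1F
  c = M 1F 0F
  d = M 1F 1F
  competitor : Matrix 2
  competitor = matrix2 0 λ₂ λ₂ (λ₁ ∸ λ₂)
  competitor-shape : rskShape competitor ≡ λ₁ ∷ λ₂ ∷ []
  competitor-shape = trans (rskShape-antidiagonal competitor refl refl) (cong (λ l → l ∷ λ₂ ∷ []) (m+[n∸m]≡n λ₂≤λ₁))
  b*c≤λ₂*λ₂ : b * c ≤ λ₂ * λ₂
  b*c≤λ₂*λ₂ = subst₂ _≤_ (inversions-matrix2 M) (inversions-matrix2 competitor) (minimal competitor competitor-shape)
  b≡λ₂×c≡λ₂ : b ≡ λ₂ × c ≡ λ₂
  b≡λ₂×c≡λ₂ = m⊓n≡o∧m*n≤o*o⇒m≡o×n≡o (proj₂ (rskShape-two-rows M shape)) b*c≤λ₂*λ₂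
  b≡λ₂ : b ≡ λ₂
  b≡λ₂ = proj₁ b≡λ₂×c≡λ₂
  c≡λ₂ : c ≡ λ₂
  c≡λ₂ = proj₂ b≡λ₂×c≡λ₂
  b≡c : b ≡ c
  b≡c = trans b≡λ₂ (sym c≡λ₂)
  a+d≡λ₁∸λ₂ : a + d ≡ λ₁ ∸ λ₂
  a+d≡λ₁∸λ₂ = trace-antidiagonal M b≡λ₂ c≡λ₂ shape
  a≤λ₁∸λ₂ : a ≤ λ₁ ∸ λ₂
  a≤λ₁∸λ₂ = subst (a ≤_) a+d≡λ₁∸λ₂ (m≤m+n a d)
  d≡λ₁∸λ₂∸a : d ≡ λ₁ ∸ λ₂ ∸ a
  d≡λ₁∸λ₂∸a = trans (sym (m+n∸m≡n a d)) (cong (_∸ a) a+d≡λ₁∸λ₂)
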